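{- Let $B$ be the class of all small extensional trees, let $\mathrm{Rel}$ be the collection of all binary relations on $B$, and let $\Phi:\mathrm{Rel}\to\mathrm{Rel}$ be defined by: $t\,\Phi(R)\,s$ iff for every child $t'$ of $t$ there exists a child $s'$ of $s$ with $t'\,R\,s'$, and for every child $s'$ of $s$ there exists a child $t'$ of $t$ with $t'\,R\,s'$. Then for every descending chain $(R_i)_{i\in\mathrm{Ord}}$ in $\mathrm{Rel}$ indexed by the small ordinals (i.e. $R_j\subseteq R_i$ for $i\le j$), we have $\Phi\bigl(\bigcap_{i\in\mathrm{Ord}}R_i\bigr)=\bigcap_{i\in\mathrm{Ord}}\Phi(R_i)$.
   Context: Fix a strongly inaccessible uncountable cardinal $\aleph$; "small" means of cardinality $<\aleph$, and $\mathrm{Ord}$ is the class of small ordinals. Trees are rooted, non-ordered, unlabelled trees with a small set of nodes, taken up to isomorphism; a "child" of a tree $t$ means the subtree of $t$ rooted at a child of the root. A tree is extensional iff any two distinct siblings (at any node) define non-isomorphic subtrees. -}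

module Defs where

open import Level using (0ℓ) renaming (suc to lsuc)
open import Data.Product using (Σ; Σ-syntax; _×_; _,_; proj₁; proj₂)
open import Relation.Binary.PropositionalEquality using (_≡_; _≢_)
open import Relation.Nullary using (¬_)
open import Function.Bundles using (_↔_; Inverse)

-- "Small" = lives in Set (= Set₀); the inaccessible ℵ is modelled by the
-- universe Set, classes of small objects live in Set₁.

-- Trees: rooted, unordered, unlabelled, with a small set of nodes.
-- Nodes have finite depth but branches may be infinite.  Without
-- coinduction (forbidden here) we present a tree by a small pointed
-- "children structure": a small type of nodes, a root, and for every
-- node a small type of children and the child map.  The tree denoted is
-- the unfolding from the root: its nodes are the finite paths from the
-- root (a small set).  Every small tree arises this way (take its own
-- nodes), and two presentations denote the same tree iff they are
-- isomorphic in the sense of _≅_ below.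

record Tree : Set₁ where
  field
    Node : Set
    root : Node
    Kid  : Node → Set
    go   : (n : Node) → Kid n → Node
open Tree public

at : (t : Tree) → Node t → Tree
at t n = record { Node = Node t ; root = n ; Kid = Kid t ; go = go t }

Idx : Tree → Set
Idx t = Kid t (root t)

child : (t : Tree) → Idx t → Tree
child t i = at t (go t (root t) i)

-- This is a
-- level-by-level bijection of the node sets preserving the parent map,
-- i.e. a rooted tree isomorphism.
_≅_ : Tree → Tree → Set₁
t ≅ s = Σ[ Q ∈ (Node t → Node s → Set) ]
          ( Q (root t) (root s)
          × (∀ n m → Q n m →
               Σ[ b ∈ (Kid t n ↔ Kid s m) ]
                 ((k : Kid t n) → Q (go t n k) (go s m (Inverse.to b k)))) )

data Reach (t : Tree) (from : Node t) : Node t → Set where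
  here : Reach t from from
  step : ∀ {n} → Reach t from n → (k : Kid t n) → Reach t from (go t n k)

Extensional : Tree → Set₁
Extensional t = ∀ n → Reach t (root t) n →
  (k k' : Kid t n) → k ≢ k' → ¬ (at t (go t n k) ≅ at t (go t n k'))

reach-child : (t : Tree) (i : Idx t) {n : Node t} →
  Reach (child t i) (go t (root t) i) n → Reach t (root t) n
reach-child t i here = step here i
reach-child t i (step r k) = step (reach-child t i r) k

sub : (t : Tree) → Extensional t → (i : Idx t) → Extensional (child t i)
sub t e i n r = e n (reach-child t i r)

B : Set₁
B = Σ Tree Extensional

ChildIdx : B → Set
ChildIdx t = Idx (proj₁ t)

childB : (t : B) → ChildIdx t → B
childB t i = child (proj₁ t) i , sub (proj₁ t) (proj₂ t) i

_≅B_ : B → B → Set₁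
t ≅B s = proj₁ t ≅ proj₁ s

-- Binary relations on B.  Since B consists of trees up to isomorphism,
-- a relation on B is a relation on representatives invariant under ≅.

Rel : Set₂
Rel = B → B → Set₁

Respects≅ : Rel → Set₁
Respects≅ R = ∀ {t t' s s'} → t ≅B t' → s ≅B s' → R t s → R t' s'

_⊆_ : Rel → Rel → Set₁
R ⊆ S = ∀ t s → R t s → S t s

_≐_ : Rel → Rel → Set₁
R ≐ S = (R ⊆ S) × (S ⊆ R)

Φ : Rel → Rel
Φ R t s =
  ((i : ChildIdx t) → Σ[ j ∈ ChildIdx s ] R (childB t i) (childB s j))
  × ((j : ChildIdx s) → Σ[ i ∈ ChildIdx t ] R (childB t i) (childB s j))

-- Small ordinals, as Brouwer trees with limits over arbitrary small
-- index types, ordered by the standard inductive ≤ (Kraus–Nordvall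
-- Forsberg–Xu).  Classically, modulo ≤-equivalence these are exactly
-- the ordinals < ℵ.

data Ord : Set₁ where
  zer : Ord
  suc : Ord → Ord
  lim : {A : Set} → (A → Ord) → Ord

data _≤_ : Ord → Ord → Set₁ where
  ≤-zero     : ∀ {x} → zer ≤ x
  ≤-suc      : ∀ {x y} → x ≤ y → suc x ≤ suc y
  ≤-cocone   : ∀ {x} {A : Set} {f : A → Ord} (a : A) → x ≤ f a → x ≤ lim f
  ≤-limiting : ∀ {x} {A : Set} {f : A → Ord} → ((a : A) → f a ≤ x) → lim f ≤ x

⋂ : (Ord → Rel) → Rel
⋂ R t s = (i : Ord) → R i t s

Descending : (Ord → Rel) → Set₁
Descending R = ∀ {i j} → i ≤ j → R j ⊆ R i

-- Φ (⋂ R) ⊆ ⋂ Φ(R i) is just monotonicity of Φ.  Conversely, fix a child t'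
-- of t and suppose that no child s' of s is R_i-related to t' at every stage
-- i.  Choose for each s' a stage f(s') where it fails; since s has only a
-- small set of children, κ = sup f is again a small ordinal.  At stage κ some
-- child s' is R_κ-related to t', but R_κ ⊆ R_f(s'), a contradiction.
module Submission where

open import Defs
open import Level using (0ℓ) renaming (suc to lsuc)
open import Axiom.ExcludedMiddle using (ExcludedMiddle)
open import Axiom.DoubleNegationElimination using (em⇒dne)
open import Data.Product using (Σ; Σ-syntax; _×_; _,_; proj₁; proj₂)
open import Relation.Nullary using (¬_)

≤-refl : ∀ x → x ≤ x
≤-refl zer     = ≤-zero
≤-refl (suc x) = ≤-suc (≤-refl x)
≤-refl (lim f) = ≤-limiting (λ a → ≤-cocone a (≤-refl (f a)))

f≤lim : {A : Set} (f : A → Ord) (a : A) → f a ≤ lim f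
f≤lim f a = ≤-cocone a (≤-refl (f a))

¬∀⇒∃¬ : ExcludedMiddle (lsuc 0ℓ) → {P : Ord → Set₁} →
  ¬ (∀ i → P i) → Σ[ i ∈ Ord ] ¬ P i
¬∀⇒∃¬ em ¬∀P = em⇒dne em λ ¬∃¬P → ¬∀P λ i → em⇒dne em λ ¬Pi → ¬∃¬P (i , ¬Pi)

antitone-∀∃⇒∃∀ : ExcludedMiddle (lsuc 0ℓ) → {J : Set} (P : Ord → J → Set₁) →
  (∀ {i k} → i ≤ k → ∀ j → P k j → P i j) →
  (∀ i → Σ[ j ∈ J ] P i j) → Σ[ j ∈ J ] (∀ i → P i j)
antitone-∀∃⇒∃∀ em {J} P antitone witness = em⇒dne em ¬¬∃∀
  where
  ¬¬∃∀ : ¬ ¬ (Σ[ j ∈ J ] (∀ i → P i j))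
  ¬¬∃∀ ¬∃∀ = ¬P-at-failure (antitone (f≤lim failure j) j Pκj)
    where
    failing-stage : (j : J) → Σ[ i ∈ Ord ] ¬ P i j
    failing-stage j = ¬∀⇒∃¬ em λ ∀P → ¬∃∀ (j , ∀P)

    failure : J → Ord
    failure j = proj₁ (failing-stage j)

    j : J
    j = proj₁ (witness (lim failure))

    Pκj : P (lim failure) j
    Pκj = proj₂ (witness (lim failure))

    ¬P-at-failure : ¬ P (failure j) j
    ¬P-at-failure = proj₂ (failing-stage j)

Φ-mono : ∀ {R S} → R ⊆ S → Φ R ⊆ Φ S
Φ-mono R⊆S t s (forth , back) =
    (λ a → proj₁ (forth a) , R⊆S _ _ (proj₂ (forth a)))
  , (λ b → proj₁ (back b)  , R⊆S _ _ (proj₂ (back b)))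

⋂-lowerBound : (R : Ord → Rel) (i : Ord) → ⋂ R ⊆ R i
⋂-lowerBound R i t s ⋂Rts = ⋂Rts i

Φ-⋂-⊆-⋂-Φ : (R : Ord → Rel) → Φ (⋂ R) ⊆ ⋂ (λ i → Φ (R i))
Φ-⋂-⊆-⋂-Φ R t s φ i = Φ-mono (⋂-lowerBound R i) t s φ

⋂-Φ-⊆-Φ-⋂ : ExcludedMiddle (lsuc 0ℓ) → (R : Ord → Rel) → Descending R →
  ⋂ (λ i → Φ (R i)) ⊆ Φ (⋂ R)
⋂-Φ-⊆-Φ-⋂ em R desc t s φ =
    (λ a → antitone-∀∃⇒∃∀ em (λ i b → R i (childB t a) (childB s b))
             (λ i≤k b → desc i≤k _ _) (λ i → proj₁ (φ i) a))
  , (λ b → antitone-∀∃⇒∃∀ em (λ i a → R i (childB t a) (childB s b))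
             (λ i≤k a → desc i≤k _ _) (λ i → proj₂ (φ i) b))

lemma5p4 : ExcludedMiddle (lsuc 0ℓ) →
    (R : Ord → Rel) → (∀ i → Respects≅ (R i)) → Descending R →
    Φ (⋂ R) ≐ ⋂ (λ i → Φ (R i))
lemma5p4 em R _ desc = Φ-⋂-⊆-⋂-Φ R , ⋂-Φ-⊆-Φ-⋂ em R desc
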